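{- The following hold for the multiplications $\diamond$, $\circ$, $\bullet$ on the space $\mathit{Diff}_n$ of differential operators in $n$ variables. (1) The multiplication $\diamond$ is associative: for any $X,Y,Z\in \mathit{Diff}_n$, $X\diamond(Y\diamond Z)=(X\diamond Y)\diamond Z$. (2) The multiplication $\bullet$ is associative and commutative: for any $X,Y,Z\in \mathit{Diff}_n$, $X\bullet (Y\bullet Z)=(X\bullet Y)\bullet Z$ and $X\bullet Y=Y\bullet X$. (3) For any $X\in \mathit{Vect}(n)$ and $Y,Z\in \mathit{Diff}_n$, $$(X,Y,Z)^\circ =(X\bullet Y)\circ Z,\qquad X\circ (Y\bullet Z)=(X\circ Y)\bullet Z+Y\bullet (X\circ Z),$$ where $(X,Y,Z)^\circ =X\circ(Y\circ Z)-(X\circ Y)\circ Z$ is the associator of the multiplication $\circ$. (4) For any $X,Y\in \mathit{Vect}(n)$ and $Z\in \mathit{Diff}_n$, $(X,Y,Z)^\circ =(Y,X,Z)^\circ$.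
   Context: Let $U$ be the coefficient algebra: a commutative associative unital $\mathbf{C}$-algebra of functions $u=u(x_1,\ldots,x_n)$ with the commuting $\mathbf{C}$-linear derivations $\partial_i=\partial/\partial x_i$, $i=1,\dots,n$ (only this differential-algebra structure is used; for example $U=\mathbf{C}[[x_1,\ldots,x_n]]$). For $\alpha=(\alpha_1,\dots,\alpha_n)\in\mathbf{Z}_0^n$ ($\mathbf{Z}_0$ = non-negative integers) put $\partial^\alpha=\prod_{i=1}^n\partial_i^{\alpha_i}$. $\mathit{Diff}_n$ is the space of differential operators, i.e. finite formal sums $\sum_{\alpha\in\mathbf{Z}_0^n}u_\alpha\partial^\alpha$ with $u_\alpha\in U$ (the free $U$-module on the symbols $\partial^\alpha$). $\mathit{Vect}(n)$ is the subspace of differential operators of first order, i.e. those of the form $\sum_{i=1}^n u_i\partial_i$ with $u_i\in U$. Three bilinear multiplications on $\mathit{Diff}_n$ are defined on generators by $$u\partial^\alpha \diamond v \partial^\beta=\sum_{\gamma\in \mathbf{Z}^n_0} \binom{\alpha}{\gamma} u\,\partial^\gamma(v)\,\partial^{\alpha+\beta-\gamma},\qquad u\partial^\alpha\circ v\partial^\beta=u\,\partial^\alpha(v)\,\partial^\beta,\qquad u\partial^\alpha \bullet v\partial^\beta= u v\, \partial^{\alpha+\beta},$$ where $\binom{\alpha}{\gamma}=\prod_i\binom{\alpha_i}{\gamma_i}$ (zero unless $\gamma\le\alpha$ componentwise) and $\partial^\alpha(v)$ is the iterated derivative of $v$. -}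

module Defs where

open import Algebra.Bundles using (CommutativeRing)
open import Algebra.Morphism.Structures using (IsRingHomomorphism)
import Algebra.Properties.CommutativeMonoid.Mult as Mult
import Algebra.Properties.CommutativeSemigroup as CommutativeSemigroupProperties
import Algebra.Properties.Group as GroupProperties
open import Data.Fin.Base using (Fin)
import Data.Fin.Properties as Fin
open import Data.List.Base as List
  using (List; []; _∷_; _++_; allFin; cartesianProductWith; concatMap; deduplicate; upTo)
open import Data.List.Membership.Propositional using (_∈_)
open import Data.List.Membership.Propositional.Properties using (∈-deduplicate⁺; ∈-++⁺ˡ; ∈-++⁺ʳ)
open import Data.List.Relation.Unary.All as All using ([]; _∷_)
open import Data.List.Relation.Unary.AllPairs using ([]; _∷_)
open import Data.List.Relation.Unary.Any using (here; there)
open import Data.List.Relation.Unary.Unique.Propositional using (Unique)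
open import Data.List.Relation.Unary.Unique.DecPropositional.Properties using (deduplicate-!)
open import Data.Nat.Base as ℕ using (ℕ)
open import Data.Nat.Combinatorics using (_C_)
import Data.Nat.GeneralisedArithmetic as ℕ
import Data.Nat.Properties as ℕ
open import Data.Product.Base using (_×_; _,_; proj₁; proj₂; ∃; map₁)
open import Data.Vec.Base as Vec using (Vec; []; _∷_; zipWith; lookup; tabulate)
open import Data.Vec.Properties using (≡-dec)
open import Data.Bool.Base using (true; false; if_then_else_)
open import Level using (Level; _⊔_; suc)
open import Relation.Binary.Definitions using (DecidableEquality)
open import Relation.Binary.PropositionalEquality as ≡ using (_≡_; _≢_)
open import Relation.Nullary.Decidable using (does; yes; no)
open import Relation.Nullary.Negation using (contradiction)

-- A commutative unital K-algebra, given by its structure map ι : K → U, with n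
-- commuting K-linear derivations.  The scalars K are left arbitrary (the case of
-- interest is the complex numbers).
record DifferentialAlgebra {k ℓₖ} (K : CommutativeRing k ℓₖ) (n : ℕ) (c ℓ : Level)
       : Set (k ⊔ ℓₖ ⊔ suc (c ⊔ ℓ)) where
  private module K = CommutativeRing K
  field
    commutativeRing : CommutativeRing c ℓ
  open CommutativeRing commutativeRing public
  field
    ι                  : K.Carrier → Carrier
    ι-isRingHomomorphism : IsRingHomomorphism K.rawRing rawRing ι
    ∂                  : Fin n → Carrier → Carrier
    ∂-cong             : ∀ i {u v} → u ≈ v → ∂ i u ≈ ∂ i v
    ∂-+                : ∀ i u v → ∂ i (u + v) ≈ ∂ i u + ∂ i v
    ∂-scalar           : ∀ i a u → ∂ i (ι a * u) ≈ ι a * ∂ i u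
    ∂-leibniz          : ∀ i u v → ∂ i (u * v) ≈ ∂ i u * v + u * ∂ i v
    ∂-comm             : ∀ i j u → ∂ i (∂ j u) ≈ ∂ j (∂ i u)

Exponent : ℕ → Set
Exponent n = Vec ℕ n

_≟ᵉ_ : ∀ {n} → DecidableEquality (Exponent n)
_≟ᵉ_ = ≡-dec ℕ._≟_

_+ᵉ_ _∸ᵉ_ : ∀ {n} → Exponent n → Exponent n → Exponent n
_+ᵉ_ = zipWith ℕ._+_
_∸ᵉ_ = zipWith ℕ._∸_

infixl 6 _+ᵉ_ _∸ᵉ_

single : ∀ {n} → Fin n → Exponent n
single i = tabulate λ j → if does (i Fin.≟ j) then 1 else 0

binom : ∀ {n} → Exponent n → Exponent n → ℕ
binom []      []      = 1
binom (a ∷ α) (g ∷ γ) = (a C g) ℕ.* binom α γ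

-- All γ with γ ≤ α componentwise, each listed once.
below : ∀ {n} → Exponent n → List (Exponent n)
below []      = [] ∷ []
below (a ∷ α) = cartesianProductWith _∷_ (upTo (ℕ.suc a)) (below α)

module DifferentialOperators
  {k ℓₖ c ℓ} {K : CommutativeRing k ℓₖ} {n : ℕ} (U : DifferentialAlgebra K n c ℓ) where

  open DifferentialAlgebra U
  open Mult +-commutativeMonoid using (×-congʳ; ×-distrib-+) renaming (_×_ to _×ᵘ_)

  ∂^ : Exponent n → Carrier → Carrier
  ∂^ α v = List.foldr (λ i w → ℕ.fold w (∂ i) (lookup α i)) v (allFin n)

  -- The list of (u , α) stands for the formal sum of the u ∂^α.  Exponents may
  -- repeat, so elements of the free module are lists up to _≋_.
  Diff : Set c
  Diff = List (Carrier × Exponent n)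

  coeff : Diff → Exponent n → Carrier
  coeff []            β = 0#
  coeff ((u , α) ∷ X) β = (if does (α ≟ᵉ β) then u else 0#) + coeff X β

  infix 4 _≋_
  _≋_ : Diff → Diff → Set ℓ
  X ≋ Y = ∀ β → coeff X β ≈ coeff Y β

  infixl 6 _⊕_ _⊖_
  _⊕_ _⊖_ : Diff → Diff → Diff
  X ⊕ Y = X ++ Y
  X ⊖ Y = X ++ List.map (map₁ (-_)) Y

  firstOrder : (Fin n → Carrier) → Diff
  firstOrder u = List.map (λ i → u i , single i) (allFin n)

  Vect : Diff → Set (c ⊔ ℓ)
  Vect X = ∃ λ u → X ≋ firstOrder u

  bilinear : (Carrier × Exponent n → Carrier × Exponent n → Diff) → Diff → Diff → Diff
  bilinear f X Y = concatMap (λ s → concatMap (f s) Y) X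

  diamondGen circGen bulletGen : Carrier × Exponent n → Carrier × Exponent n → Diff
  -- The sum over all γ is cut down to γ ≤ α, outside of which the binomials vanish;
  -- within this range the truncated subtraction α + β ∸ γ is exact.
  diamondGen (u , α) (v , β) =
    List.map (λ γ → binom α γ ×ᵘ (u * ∂^ γ v) , α +ᵉ β ∸ᵉ γ) (below α)
  circGen    (u , α) (v , β) = (u * ∂^ α v , β) ∷ []
  bulletGen  (u , α) (v , β) = (u * v , α +ᵉ β) ∷ []

  infixl 7 _⋄_ _∘_ _•_
  _⋄_ _∘_ _•_ : Diff → Diff → Diff
  _⋄_ = bilinear diamondGen
  _∘_ = bilinear circGen
  _•_ = bilinear bulletGen

  associator∘ : Diff → Diff → Diff → Diff
  associator∘ X Y Z = X ∘ (Y ∘ Z) ⊖ (X ∘ Y) ∘ Z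

  open import Relation.Binary.Reasoning.Setoid setoid
  open CommutativeSemigroupProperties +-commutativeSemigroup using (interchange)
  open GroupProperties +-group using (identityˡ-unique)

  Additive : (Carrier → Carrier) → Set (c ⊔ ℓ)
  Additive g = (∀ {u v} → u ≈ v → g u ≈ g v) × (∀ u v → g (u + v) ≈ g u + g v)

  additive-0# : ∀ {g} → Additive g → g 0# ≈ 0#
  additive-0# {g} (g-cong , g-+) =
    identityˡ-unique (g 0#) (g 0#) (trans (sym (g-+ 0# 0#)) (g-cong (+-identityˡ 0#)))

  additive-∘ : ∀ {f g} → Additive f → Additive g → Additive (λ u → f (g u))
  additive-∘ (f-cong , f-+) (g-cong , g-+) =
    (λ e → f-cong (g-cong e)) , λ u v → trans (f-cong (g-+ u v)) (f-+ _ _)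

  additive-zero : Additive (λ _ → 0#)
  additive-zero = (λ _ → refl) , λ _ _ → sym (+-identityˡ 0#)

  additive-sum : ∀ {f g} → Additive f → Additive g → Additive (λ u → f u + g u)
  additive-sum (f-cong , f-+) (g-cong , g-+) =
    (λ e → +-cong (f-cong e) (g-cong e)) ,
    λ u v → trans (+-cong (f-+ u v) (g-+ u v)) (interchange _ _ _ _)

  additive-if : ∀ b → Additive (λ u → if b then u else 0#)
  additive-if true  = (λ e → e) , λ _ _ → refl
  additive-if false = additive-zero

  additive-fold : ∀ i m → Additive (λ u → ℕ.fold u (∂ i) m)
  additive-fold i ℕ.zero    = (λ e → e) , λ _ _ → refl
  additive-fold i (ℕ.suc m) = additive-∘ (∂-cong i , ∂-+ i) (additive-fold i m)

  additive-foldr : ∀ α (is : List (Fin n)) →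
    Additive (λ u → List.foldr (λ i w → ℕ.fold w (∂ i) (lookup α i)) u is)
  additive-foldr α []       = (λ e → e) , λ _ _ → refl
  additive-foldr α (i ∷ is) = additive-∘ (additive-fold i (lookup α i)) (additive-foldr α is)

  additive-∂^ : ∀ α → Additive (∂^ α)
  additive-∂^ α = additive-foldr α (allFin n)

  additive-*ˡ : ∀ v → Additive (λ u → u * v)
  additive-*ˡ v = *-congʳ , λ x y → distribʳ v x y

  additive-*ʳ : ∀ u → Additive (λ v → u * v)
  additive-*ʳ u = *-congˡ , distribˡ u

  additive-× : ∀ m → Additive (m ×ᵘ_)
  additive-× m = ×-congʳ m , λ x y → ×-distrib-+ x y m

  total : (Carrier → Exponent n → Carrier) → Diff → Carrier
  total g []            = 0#
  total g ((u , α) ∷ X) = g u α + total g X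

  total-cong : ∀ {g h} → (∀ u α → g u α ≈ h u α) → ∀ X → total g X ≈ total h X
  total-cong e []            = refl
  total-cong e ((u , α) ∷ X) = +-cong (e u α) (total-cong e X)

  total-additive : ∀ (g : Carrier → Carrier → Exponent n → Carrier) →
    (∀ v α → Additive (λ u → g u v α)) → ∀ Y → Additive (λ u → total (g u) Y)
  total-additive g a []            = additive-zero
  total-additive g a ((v , α) ∷ Y) = additive-sum (a v α) (total-additive g a Y)

  coeff-++ : ∀ X Y β → coeff (X ++ Y) β ≈ coeff X β + coeff Y β
  coeff-++ []      Y β = sym (+-identityˡ _)
  coeff-++ (_ ∷ X) Y β = trans (+-congˡ (coeff-++ X Y β)) (sym (+-assoc _ _ _))

  coeff-concatMap : ∀ h X β →
    coeff (concatMap h X) β ≈ total (λ u α → coeff (h (u , α)) β) X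
  coeff-concatMap h []      β = refl
  coeff-concatMap h (s ∷ X) β =
    trans (coeff-++ (h s) (concatMap h X) β) (+-congˡ (coeff-concatMap h X β))

  module _ (g : Carrier → Exponent n → Carrier) (a : ∀ α → Additive (λ u → g u α)) where

    totalOver : List (Exponent n) → (Exponent n → Carrier) → Carrier
    totalOver []      p = 0#
    totalOver (β ∷ E) p = g (p β) β + totalOver E p

    over-cong : ∀ E {p q} → (∀ β → p β ≈ q β) → totalOver E p ≈ totalOver E q
    over-cong []      e = refl
    over-cong (β ∷ E) e = +-cong (proj₁ (a β) (e β)) (over-cong E e)

    over-+ : ∀ E p q → totalOver E (λ β → p β + q β) ≈ totalOver E p + totalOver E q
    over-+ []      p q = sym (+-identityˡ _)
    over-+ (β ∷ E) p q =
      trans (+-cong (proj₂ (a β) _ _) (over-+ E p q)) (interchange _ _ _ _)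

    over-0# : ∀ E → totalOver E (λ _ → 0#) ≈ 0#
    over-0# []      = refl
    over-0# (β ∷ E) = trans (+-cong (additive-0# (a β)) (over-0# E)) (+-identityˡ _)

    δ : Carrier → Exponent n → Exponent n → Carrier
    δ u α β = if does (α ≟ᵉ β) then u else 0#

    over-δ∉ : ∀ E u α → All.All (α ≢_) E → totalOver E (δ u α) ≈ 0#
    over-δ∉ []      u α []          = refl
    over-δ∉ (β ∷ E) u α (α≢β ∷ α∉E) with α ≟ᵉ β
    ... | yes α≡β = contradiction α≡β α≢β
    ... | no  _   =
      trans (+-cong (additive-0# (a β)) (over-δ∉ E u α α∉E)) (+-identityˡ _)

    over-δ∈ : ∀ E u α → Unique E → α ∈ E → totalOver E (δ u α) ≈ g u α
    over-δ∈ (β ∷ E) u α (β∉E ∷ E!) α∈ with α ≟ᵉ β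
    over-δ∈ (β ∷ E) u α (β∉E ∷ E!) α∈ | yes ≡.refl =
      trans (+-congˡ (over-δ∉ E u α β∉E)) (+-identityʳ _)
    over-δ∈ (β ∷ E) u α (β∉E ∷ E!) (here α≡β) | no α≢β = contradiction α≡β α≢β
    over-δ∈ (β ∷ E) u α (β∉E ∷ E!) (there α∈) | no α≢β =
      trans (+-cong (additive-0# (a β)) (over-δ∈ E u α E! α∈)) (+-identityˡ _)

    total-over : ∀ E X → Unique E → (∀ {α} → α ∈ List.map proj₂ X → α ∈ E) →
                 total g X ≈ totalOver E (coeff X)
    total-over E []            E! X⊆E = sym (over-0# E)
    total-over E ((u , α) ∷ X) E! X⊆E = sym (trans
      (over-+ E (δ u α) (coeff X))
      (+-cong (over-δ∈ E u α E! (X⊆E (here ≡.refl)))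
              (sym (total-over E X E! λ α∈ → X⊆E (there α∈)))))

    total-≋ : ∀ {X Y} → X ≋ Y → total g X ≈ total g Y
    total-≋ {X} {Y} X≋Y = begin
      total g X             ≈⟨ total-over E X E! (λ α∈ → ∈-deduplicate⁺ _≟ᵉ_ (∈-++⁺ˡ α∈)) ⟩
      totalOver E (coeff X) ≈⟨ over-cong E X≋Y ⟩
      totalOver E (coeff Y) ≈⟨ total-over E Y E!
                                 (λ α∈ → ∈-deduplicate⁺ _≟ᵉ_ (∈-++⁺ʳ (List.map proj₂ X) α∈)) ⟨
      total g Y             ∎
      where
      E : List (Exponent n)
      E = deduplicate _≟ᵉ_ (List.map proj₂ X ++ List.map proj₂ Y)
      E! : Unique E
      E! = deduplicate-! _≟ᵉ_ (List.map proj₂ X ++ List.map proj₂ Y)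

  coeff-map-additive : (p : Exponent n → Carrier → Carrier) (e : Exponent n → Exponent n) →
    (∀ γ → Additive (p γ)) → ∀ G β →
    Additive (λ u → coeff (List.map (λ γ → p γ u , e γ) G) β)
  coeff-map-additive p e a []      β = additive-zero
  coeff-map-additive p e a (γ ∷ G) β =
    additive-sum (additive-∘ (additive-if (does (e γ ≟ᵉ β))) (a γ)) (coeff-map-additive p e a G β)

  module _ (f : Carrier × Exponent n → Carrier × Exponent n → Diff)
           (aˡ : ∀ α v β γ → Additive (λ u → coeff (f (u , α) (v , β)) γ))
           (aʳ : ∀ u α β γ → Additive (λ v → coeff (f (u , α) (v , β)) γ)) where

    coeff-bilinear : ∀ X Y γ → coeff (bilinear f X Y) γ
      ≈ total (λ u α → total (λ v β → coeff (f (u , α) (v , β)) γ) Y) X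
    coeff-bilinear X Y γ = trans (coeff-concatMap (λ s → concatMap (f s) Y) X γ)
      (total-cong (λ u α → coeff-concatMap (f (u , α)) Y γ) X)

    bilinear-cong : ∀ {X X′ Y Y′} → X ≋ X′ → Y ≋ Y′ → bilinear f X Y ≋ bilinear f X′ Y′
    bilinear-cong {X} {X′} {Y} {Y′} X≋X′ Y≋Y′ γ = begin
      coeff (bilinear f X Y) γ                     ≈⟨ coeff-bilinear X Y γ ⟩
      total (λ u α → total (λ v → F u α v) Y) X    ≈⟨ total-≋ _ (λ α → total-additive
                                                        (λ u v β → F u α v β)
                                                        (λ v β → aˡ α v β γ) Y) {X} {X′} X≋X′ ⟩
      total (λ u α → total (λ v → F u α v) Y) X′   ≈⟨ total-cong (λ u α →
                                                        total-≋ _ (λ β → aʳ u α β γ) {Y} {Y′} Y≋Y′) X′ ⟩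
      total (λ u α → total (λ v → F u α v) Y′) X′  ≈⟨ coeff-bilinear X′ Y′ γ ⟨
      coeff (bilinear f X′ Y′) γ                   ∎
      where
      F : Carrier → Exponent n → Carrier → Exponent n → Carrier
      F u α v β = coeff (f (u , α) (v , β)) γ

  coeff-single-additive : ∀ {g} → Additive g → ∀ α β → Additive (λ u → coeff ((g u , α) ∷ []) β)
  coeff-single-additive a α β =
    additive-sum (additive-∘ (additive-if (does (α ≟ᵉ β))) a) additive-zero

  ⋄-cong : ∀ {X X′ Y Y′} → X ≋ X′ → Y ≋ Y′ → X ⋄ Y ≋ X′ ⋄ Y′
  ⋄-cong {X} {X′} {Y} {Y′} = bilinear-cong diamondGen
    (λ α v β γ → coeff-map-additive (λ δ u → binom α δ ×ᵘ (u * ∂^ δ v)) _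
      (λ δ → additive-∘ (additive-× (binom α δ)) (additive-*ˡ (∂^ δ v))) (below α) γ)
    (λ u α β γ → coeff-map-additive (λ δ v → binom α δ ×ᵘ (u * ∂^ δ v)) _
      (λ δ → additive-∘ (additive-× (binom α δ)) (additive-∘ (additive-*ʳ u) (additive-∂^ δ)))
      (below α) γ)
    {X} {X′} {Y} {Y′}

  ∘-cong : ∀ {X X′ Y Y′} → X ≋ X′ → Y ≋ Y′ → X ∘ Y ≋ X′ ∘ Y′
  ∘-cong {X} {X′} {Y} {Y′} = bilinear-cong circGen
    (λ α v β γ → coeff-single-additive (additive-*ˡ (∂^ α v)) β γ)
    (λ u α β γ → coeff-single-additive (additive-∘ (additive-*ʳ u) (additive-∂^ α)) β γ)
    {X} {X′} {Y} {Y′}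

  •-cong : ∀ {X X′ Y Y′} → X ≋ X′ → Y ≋ Y′ → X • Y ≋ X′ • Y′
  •-cong {X} {X′} {Y} {Y′} = bilinear-cong bulletGen
    (λ α v β γ → coeff-single-additive (additive-*ˡ v) (α +ᵉ β) γ)
    (λ u α β γ → coeff-single-additive (additive-*ʳ u) (α +ᵉ β) γ)
    {X} {X′} {Y} {Y′}

module Submission where

-- Let A i be the additive map of Diff that applies ∂ i to all coefficients, B i the
-- one that multiplies every symbol ∂^ α by ∂ i, and L u the multiplication of all
-- coefficients by u.  For a family F of n additive maps, substituting F i for the
-- symbol ∂ i gives
--
--     eval F (Σ u ∂^ α)  =  Σ L u F^α ,
--
-- and the three multiplications are three instances of this substitution:
--
--     X ⋄ Y = eval (A + B) X Y ,   X ∘ Y = eval A X Y ,   X • Y = eval B X Y .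
--
-- The last two amount to computing A^α and B^α.  For the first, every A i commutes
-- with every B j, so the binomial theorem for multi-indices (monomial-+) expands
-- (A + B)^α into the terms A^γ B^(α - γ) of the definition of ⋄ (monomial-D).
--
-- Write D = A + B.  The central point is a criterion for G to satisfy
--
--     eval F (eval G X Y)  =  eval F X (eval F Y) :
--
-- it suffices that eval F (G i Y) = F i (eval F Y) for all i and Y (intertwines-eval).
-- With G = D this holds as soon as the F i commute with one another and satisfy
-- F i L u = L (∂ i u) + L u F i (intertwines-D), which is the case for F = D and for
-- F = A.  The first choice is the associativity of ⋄, the second is the identity
-- X ∘ (Y ∘ Z) = (X ⋄ Y) ∘ Z.  With F = G = B it is the associativity of •.
-- The commutativity of • holds because all the L u and B i commute.
--
-- If X is of first order, then D = A + B gives X ⋄ Y = X ∘ Y + X • Y, so the identity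
-- X ∘ (Y ∘ Z) = (X ⋄ Y) ∘ Z computes the associator as (X • Y) ∘ Z, which is
-- symmetric in X and Y when both are of first order.  Finally, each A i is a
-- derivation of •, and derivations of • are stable under sums and under
-- multiplication by functions, so X ∘ is a derivation of • as well.

open import Defs
open import Algebra.Bundles using (CommutativeMonoid; CommutativeRing; Semiring)
import Algebra.Morphism.Construct.Composition as Composition
import Algebra.Morphism.Construct.Identity as Identity
open import Algebra.Morphism.Structures using (IsMonoidHomomorphism)
import Algebra.Properties.AbelianGroup as AbelianGroupProperties
import Algebra.Properties.CommutativeSemigroup as CommutativeSemigroupProperties
import Algebra.Properties.Semiring.Binomial as Binomial
import Algebra.Properties.Semiring.Exp as Exp
import Algebra.Properties.Semiring.Mult as SemiringMult
import Algebra.Properties.Semiring.Sum as SemiringSum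
open import Data.Bool.Base using (true; false; if_then_else_)
open import Data.Fin.Base using (Fin; zero; suc; toℕ)
open import Data.List.Base as List
  using (List; []; _∷_; _++_; allFin; applyUpTo; cartesianProductWith; concatMap; foldr; upTo)
import Data.List.Properties as List
open import Data.List.Relation.Unary.All as All using (All; []; _∷_)
import Data.List.Relation.Unary.All.Properties as All
open import Data.Nat.Base as ℕ using (ℕ; zero; suc)
open import Data.Nat.Combinatorics using (_C_)
import Data.Nat.GeneralisedArithmetic as ℕ
import Data.Nat.Properties as ℕ
open import Data.Product.Base using (_×_; _,_; proj₁; proj₂; map₁; map₂)
open import Data.Vec.Base as Vec using ([]; _∷_; lookup)
import Data.Vec.Properties as Vec
import Function.Base as Fun
open import Level using (_⊔_)
open import Relation.Binary.PropositionalEquality as ≡ using (_≡_)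
import Relation.Binary.Reasoning.Setoid as SetoidReasoning
open import Relation.Nullary.Decidable using (does)

-- Arithmetic of exponents

0ᵉ : ∀ {n} → Exponent n
0ᵉ = Vec.replicate _ 0

+ᵉ-identityˡ : ∀ {n} (α : Exponent n) → 0ᵉ +ᵉ α ≡ α
+ᵉ-identityˡ = Vec.zipWith-identityˡ ℕ.+-identityˡ

+ᵉ-identityʳ : ∀ {n} (α : Exponent n) → α +ᵉ 0ᵉ ≡ α
+ᵉ-identityʳ = Vec.zipWith-identityʳ ℕ.+-identityʳ

+ᵉ-assoc : ∀ {n} (α β γ : Exponent n) → (α +ᵉ β) +ᵉ γ ≡ α +ᵉ (β +ᵉ γ)
+ᵉ-assoc = Vec.zipWith-assoc ℕ.+-assoc

+ᵉ-comm : ∀ {n} (α β : Exponent n) → α +ᵉ β ≡ β +ᵉ α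
+ᵉ-comm = Vec.zipWith-comm ℕ.+-comm

single-zero : ∀ n → single {suc n} zero ≡ 1 ∷ 0ᵉ
single-zero n = ≡.cong (1 ∷_) (zeros n)
  where
  zeros : ∀ n → Vec.tabulate {n = n} (λ _ → 0) ≡ 0ᵉ
  zeros zero    = ≡.refl
  zeros (suc n) = ≡.cong (0 ∷_) (zeros n)

All-cartesianProductWith : ∀ {a b c p q r} {A : Set a} {B : Set b} {C : Set c}
  {P : A → Set p} {Q : B → Set q} {R : C → Set r} {f : A → B → C} {xs ys} →
  (∀ {x y} → P x → Q y → R (f x y)) →
  All P xs → All Q ys → All R (cartesianProductWith f xs ys)
All-cartesianProductWith r []         qs = []
All-cartesianProductWith r (px ∷ pxs) qs =
  All.++⁺ (All.map⁺ (All.map (r px) qs)) (All-cartesianProductWith r pxs qs)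

-- For γ ≤ α, the range of the sum in the definition of ⋄, the truncated differences
-- may be rearranged.
below-exact : ∀ {n} (α β : Exponent n) →
  All (λ γ → (α ∸ᵉ γ) +ᵉ β ≡ (α +ᵉ β) ∸ᵉ γ) (below α)
below-exact []      []      = ≡.refl ∷ []
below-exact (a ∷ α) (b ∷ β) = All-cartesianProductWith
  (λ k≤a e → ≡.cong₂ _∷_ (≡.sym (ℕ.+-∸-comm b (ℕ.s≤s⁻¹ k≤a))) e)
  (All.all-upTo (suc a)) (below-exact α β)

-- Monomials in a semiring

module Monomials {a ℓ} (S : Semiring a ℓ) where

  open Semiring S hiding (zero)
  open SemiringMult S renaming (_×_ to _×ⁿ_)
  open Exp S
  open SemiringSum S using (sum)
  open import Relation.Binary.Reasoning.Setoid setoid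

  Commute : Carrier → Carrier → Set ℓ
  Commute x y = x * y ≈ y * x

  commute-1 : ∀ x → Commute x 1#
  commute-1 x = trans (*-identityʳ x) (sym (*-identityˡ x))

  commute-+ : ∀ {x y z} → Commute x y → Commute x z → Commute x (y + z)
  commute-+ xy xz = trans (distribˡ _ _ _) (trans (+-cong xy xz) (sym (distribʳ _ _ _)))

  commute-* : ∀ {x y z} → Commute x y → Commute x z → Commute x (y * z)
  commute-* {x} {y} {z} xy xz = begin
    x * (y * z)  ≈⟨ *-assoc x y z ⟨
    x * y * z    ≈⟨ *-congʳ xy ⟩
    y * x * z    ≈⟨ *-assoc y x z ⟩
    y * (x * z)  ≈⟨ *-congˡ xz ⟩
    y * (z * x)  ≈⟨ *-assoc y z x ⟨
    y * z * x    ∎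

  commute-^ : ∀ {x y} → Commute x y → ∀ k → Commute x (y ^ k)
  commute-^ xy zero    = commute-1 _
  commute-^ xy (suc k) = commute-* xy (commute-^ xy k)

  -- The ordered product of the powers f i ^ α i; the f i need not commute.
  monomial : ∀ {m} → (Fin m → Carrier) → Exponent m → Carrier
  monomial f []      = 1#
  monomial f (a ∷ α) = f zero ^ a * monomial (λ i → f (suc i)) α

  commute-monomial : ∀ {m x} {f : Fin m → Carrier} →
    (∀ i → Commute x (f i)) → ∀ α → Commute x (monomial f α)
  commute-monomial xf []      = commute-1 _
  commute-monomial xf (a ∷ α) =
    commute-* (commute-^ (xf zero) a) (commute-monomial (λ i → xf (suc i)) α)

  monomial-0 : ∀ {m} (f : Fin m → Carrier) → monomial f 0ᵉ ≈ 1#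
  monomial-0 {zero}  f = refl
  monomial-0 {suc m} f = trans (*-identityˡ _) (monomial-0 (λ i → f (suc i)))

  monomial-single : ∀ {m} (f : Fin m → Carrier) i → monomial f (single i) ≈ f i
  monomial-single {suc m} f zero    = begin
    monomial f (single zero)                      ≡⟨ ≡.cong (monomial f) (single-zero m) ⟩
    f zero ^ 1 * monomial (λ i → f (suc i)) 0ᵉ    ≈⟨ *-congˡ (monomial-0 (λ i → f (suc i))) ⟩
    f zero ^ 1 * 1#                               ≈⟨ *-identityʳ _ ⟩
    f zero * 1#                                   ≈⟨ *-identityʳ _ ⟩
    f zero                                        ∎
  monomial-single {suc m} f (suc i) = trans (*-identityˡ _) (monomial-single (λ j → f (suc j)) i)

  monomial-single-+ : ∀ {m} {f : Fin m → Carrier} → (∀ i j → Commute (f i) (f j)) →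
    ∀ i α → monomial f (single i +ᵉ α) ≈ f i * monomial f α
  monomial-single-+ {suc m} {f} ff zero (a ∷ α) = begin
    monomial f (single zero +ᵉ (a ∷ α))  ≡⟨ ≡.cong (λ ε → monomial f (ε +ᵉ (a ∷ α))) (single-zero m) ⟩
    monomial f (suc a ∷ 0ᵉ +ᵉ α)         ≡⟨ ≡.cong (λ ε → monomial f (suc a ∷ ε)) (+ᵉ-identityˡ α) ⟩
    monomial f (suc a ∷ α)               ≈⟨ *-assoc _ _ _ ⟩
    f zero * monomial f (a ∷ α)          ∎
  monomial-single-+ {suc m} {f} ff (suc i) (a ∷ α) = begin
    p * monomial f′ (single i +ᵉ α)      ≈⟨ *-congˡ (monomial-single-+ (λ j k → ff (suc j) (suc k)) i α) ⟩
    p * (f (suc i) * monomial f′ α)      ≈⟨ *-assoc _ _ _ ⟨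
    p * f (suc i) * monomial f′ α        ≈⟨ *-congʳ (commute-^ (ff (suc i) zero) a) ⟨
    f (suc i) * p * monomial f′ α        ≈⟨ *-assoc _ _ _ ⟩
    f (suc i) * (p * monomial f′ α)      ∎
    where
    p : Carrier
    p = f zero ^ a
    f′ : Fin m → Carrier
    f′ j = f (suc j)

  -- A homomorphism from the free commutative monoid of exponents is determined by
  -- its values on the generators.
  monomial-hom : ∀ {m} (χ : Exponent m → Carrier) → χ 0ᵉ ≈ 1# →
    (∀ α β → χ (α +ᵉ β) ≈ χ α * χ β) → ∀ α → monomial (λ i → χ (single i)) α ≈ χ α
  monomial-hom χ χ-0 χ-+ [] = sym χ-0
  monomial-hom {suc m} χ χ-0 χ-+ (a ∷ α) = begin
    χ (single zero) ^ a * monomial (λ i → χ (0 ∷ single i)) α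
      ≈⟨ *-cong (first a) (monomial-hom (λ β → χ (0 ∷ β)) χ-0 (λ β γ → χ-+ (0 ∷ β) (0 ∷ γ)) α) ⟩
    χ (a ∷ 0ᵉ) * χ (0 ∷ α)
      ≈⟨ χ-+ (a ∷ 0ᵉ) (0 ∷ α) ⟨
    χ (a ℕ.+ 0 ∷ 0ᵉ +ᵉ α)
      ≡⟨ ≡.cong₂ (λ b β → χ (b ∷ β)) (ℕ.+-identityʳ a) (+ᵉ-identityˡ α) ⟩
    χ (a ∷ α)
      ∎
    where
    first : ∀ a → χ (single zero) ^ a ≈ χ (a ∷ 0ᵉ)
    first zero    = sym χ-0
    first (suc a) = begin
      χ (single zero) * χ (single zero) ^ a  ≈⟨ *-cong (reflexive (≡.cong χ (single-zero m))) (first a) ⟩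
      χ (1 ∷ 0ᵉ) * χ (a ∷ 0ᵉ)                ≈⟨ χ-+ (1 ∷ 0ᵉ) (a ∷ 0ᵉ) ⟨
      χ (suc a ∷ 0ᵉ +ᵉ 0ᵉ)                   ≡⟨ ≡.cong (λ ε → χ (suc a ∷ ε)) (+ᵉ-identityˡ 0ᵉ) ⟩
      χ (suc a ∷ 0ᵉ)                         ∎

  ∑ : ∀ {i} {I : Set i} → List I → (I → Carrier) → Carrier
  ∑ xs f = foldr (λ x s → f x + s) 0# xs

  module _ {i} {I : Set i} where

    ∑-cong : ∀ (xs : List I) {f g} → (∀ x → f x ≈ g x) → ∑ xs f ≈ ∑ xs g
    ∑-cong []       e = refl
    ∑-cong (x ∷ xs) e = +-cong (e x) (∑-cong xs e)

    ∑-++ : ∀ xs ys {f : I → Carrier} → ∑ (xs ++ ys) f ≈ ∑ xs f + ∑ ys f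
    ∑-++ []       ys = sym (+-identityˡ _)
    ∑-++ (x ∷ xs) ys = trans (+-congˡ (∑-++ xs ys)) (sym (+-assoc _ _ _))

    ∑-distribˡ : ∀ (xs : List I) {f} y → y * ∑ xs f ≈ ∑ xs (λ x → y * f x)
    ∑-distribˡ []       y = zeroʳ y
    ∑-distribˡ (x ∷ xs) y = trans (distribˡ _ _ _) (+-congˡ (∑-distribˡ xs y))

    ∑-distribʳ : ∀ (xs : List I) {f} y → ∑ xs f * y ≈ ∑ xs (λ x → f x * y)
    ∑-distribʳ []       y = zeroˡ y
    ∑-distribʳ (x ∷ xs) y = trans (distribʳ _ _ _) (+-congˡ (∑-distribʳ xs y))

  ∑-cartesianProductWith : ∀ {i j k} {I : Set i} {J : Set j} {K : Set k} (h : I → J → K)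
    xs ys {f} → ∑ (cartesianProductWith h xs ys) f ≈ ∑ xs (λ x → ∑ ys (λ y → f (h x y)))
  ∑-cartesianProductWith h []       ys     = refl
  ∑-cartesianProductWith h (x ∷ xs) ys {f} = trans
    (∑-++ (List.map (h x) ys) (cartesianProductWith h xs ys))
    (+-cong (reflexive (List.foldr-map _ (h x) 0# ys)) (∑-cartesianProductWith h xs ys))

  -- Sums over Fin n, as in the binomial theorem, are sums over lists of numbers.
  sum≈∑ : ∀ (h : ℕ → ℕ) n (f : ℕ → Carrier) →
    sum {n} (λ i → f (h (toℕ i))) ≈ ∑ (applyUpTo h n) f
  sum≈∑ h zero    f = refl
  sum≈∑ h (suc n) f = +-congˡ (sum≈∑ (λ k → h (suc k)) n f)

  ×ⁿ-*-×ⁿ : ∀ m n x y → (m ×ⁿ x) * (n ×ⁿ y) ≈ (m ℕ.* n) ×ⁿ (x * y)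
  ×ⁿ-*-×ⁿ m n x y = begin
    (m ×ⁿ x) * (n ×ⁿ y)  ≈⟨ ×-assoc-* m x (n ×ⁿ y) ⟩
    m ×ⁿ (x * (n ×ⁿ y))  ≈⟨ ×-congʳ m (×-comm-* n x y) ⟩
    m ×ⁿ (n ×ⁿ (x * y))  ≈⟨ ×-assocˡ (x * y) m n ⟩
    (m ℕ.* n) ×ⁿ (x * y) ∎

  -- The binomial theorem for multi-indices.  Only the commutation of each f i with
  -- each g j is needed, as the order of the factors is the same on both sides.
  monomial-+ : ∀ {m} {f g : Fin m → Carrier} → (∀ i j → Commute (f i) (g j)) → ∀ α →
    monomial (λ i → f i + g i) α
      ≈ ∑ (below α) (λ γ → binom α γ ×ⁿ (monomial f γ * monomial g (α ∸ᵉ γ)))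
  monomial-+ fg [] = begin
    1#                         ≈⟨ *-identityˡ 1# ⟨
    1# * 1#                    ≈⟨ ×-homo-1 (1# * 1#) ⟨
    1 ×ⁿ (1# * 1#)             ≈⟨ +-identityʳ _ ⟨
    1 ×ⁿ (1# * 1#) + 0#        ∎
  monomial-+ {suc m} {f} {g} fg (a ∷ α) = begin
    (x + y) ^ a * monomial (λ i → f (suc i) + g (suc i)) α
      ≈⟨ *-cong (trans (Binomial.theorem S x y (fg zero zero) a) (sum≈∑ Fun.id (suc a) s))
                (monomial-+ (λ i j → fg (suc i) (suc j)) α) ⟩
    ∑ (upTo (suc a)) s * ∑ (below α) t
      ≈⟨ ∑-distribʳ (upTo (suc a)) (∑ (below α) t) ⟩
    ∑ (upTo (suc a)) (λ k → s k * ∑ (below α) t)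
      ≈⟨ ∑-cong (upTo (suc a)) (λ k → trans (∑-distribˡ (below α) (s k)) (∑-cong (below α) (product k))) ⟩
    ∑ (upTo (suc a)) (λ k → ∑ (below α) (λ γ → r (k ∷ γ)))
      ≈⟨ ∑-cartesianProductWith _∷_ (upTo (suc a)) (below α) ⟨
    ∑ (below (a ∷ α)) r
      ∎
    where
    x y : Carrier
    x = f zero
    y = g zero
    f′ g′ : Fin m → Carrier
    f′ i = f (suc i)
    g′ i = g (suc i)
    s : ℕ → Carrier
    s k = (a C k) ×ⁿ (x ^ k * y ^ (a ℕ.∸ k))
    t : Exponent m → Carrier
    t γ = binom α γ ×ⁿ (monomial f′ γ * monomial g′ (α ∸ᵉ γ))
    r : Exponent (suc m) → Carrier
    r γ = binom (a ∷ α) γ ×ⁿ (monomial f γ * monomial g ((a ∷ α) ∸ᵉ γ))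
    middle : ∀ {p q u v} → Commute u q → (p * q) * (u * v) ≈ (p * u) * (q * v)
    middle {p} {q} {u} {v} uq = begin
      (p * q) * (u * v)  ≈⟨ *-assoc p q (u * v) ⟩
      p * (q * (u * v))  ≈⟨ *-congˡ (*-assoc q u v) ⟨
      p * (q * u * v)    ≈⟨ *-congˡ (*-congʳ uq) ⟨
      p * (u * q * v)    ≈⟨ *-congˡ (*-assoc u q v) ⟩
      p * (u * (q * v))  ≈⟨ *-assoc p u (q * v) ⟨
      (p * u) * (q * v)  ∎
    product : ∀ k γ → s k * t γ ≈ r (k ∷ γ)
    product k γ = trans (×ⁿ-*-×ⁿ (a C k) (binom α γ) _ _) (×-congʳ (binom (a ∷ α) (k ∷ γ)) (middle
      (commute-^ (sym (commute-monomial (λ i → sym (fg (suc i) zero)) γ)) (a ℕ.∸ k))))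

-- Endomorphisms of a commutative monoid

module Endomorphisms {a ℓ} (M : CommutativeMonoid a ℓ) where

  open CommutativeMonoid M
  open CommutativeSemigroupProperties commutativeSemigroup using (interchange)

  -- The additive maps of M into itself.  Eta-equality is turned off so that two
  -- endomorphisms are never compared by unfolding their proofs of additivity.
  record End : Set (a ⊔ ℓ) where
    no-eta-equality
    field
      ⟦_⟧                  : Carrier → Carrier
      isMonoidHomomorphism : IsMonoidHomomorphism rawMonoid rawMonoid ⟦_⟧
    open IsMonoidHomomorphism isMonoidHomomorphism public

  open End public using (⟦_⟧)

  -- Pointwise equality, as a record so that the two sides can be inferred.
  infix 4 _≈ᴱ_
  record _≈ᴱ_ (f g : End) : Set (a ⊔ ℓ) where
    no-eta-equality
    constructor pointwise
    field at : ∀ x → ⟦ f ⟧ x ≈ ⟦ g ⟧ x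

  open _≈ᴱ_ public

  isAdditive : ∀ {f : Carrier → Carrier} → (∀ {x y} → x ≈ y → f x ≈ f y) →
    (∀ x y → f (x ∙ y) ≈ f x ∙ f y) → f ε ≈ ε → IsMonoidHomomorphism rawMonoid rawMonoid f
  isAdditive f-cong f-∙ f-ε = record
    { isMagmaHomomorphism = record { isRelHomomorphism = record { cong = f-cong } ; homo = f-∙ }
    ; ε-homo = f-ε }

  infixl 6 _+ᴱ_
  infixl 7 _*ᴱ_
  _+ᴱ_ _*ᴱ_ : End → End → End
  ⟦ f +ᴱ g ⟧ x = ⟦ f ⟧ x ∙ ⟦ g ⟧ x
  (f +ᴱ g) .End.isMonoidHomomorphism = isAdditive
    (λ e → ∙-cong (End.⟦⟧-cong f e) (End.⟦⟧-cong g e))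
    (λ x y → trans (∙-cong (End.homo f x y) (End.homo g x y)) (interchange _ _ _ _))
    (trans (∙-cong (End.ε-homo f) (End.ε-homo g)) (identityˡ ε))
  ⟦ f *ᴱ g ⟧ x = ⟦ f ⟧ (⟦ g ⟧ x)
  (f *ᴱ g) .End.isMonoidHomomorphism =
    Composition.isMonoidHomomorphism trans (End.isMonoidHomomorphism g) (End.isMonoidHomomorphism f)

  0ᴱ 1ᴱ : End
  ⟦ 0ᴱ ⟧ x = ε
  0ᴱ .End.isMonoidHomomorphism = isAdditive (λ _ → refl) (λ _ _ → sym (identityˡ ε)) refl
  ⟦ 1ᴱ ⟧ x = x
  1ᴱ .End.isMonoidHomomorphism = Identity.isMonoidHomomorphism rawMonoid refl

  -- The endomorphism semiring: addition is pointwise, multiplication is composition.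
  semiring : Semiring (a ⊔ ℓ) (a ⊔ ℓ)
  semiring = record
    { Carrier = End ; _≈_ = _≈ᴱ_ ; _+_ = _+ᴱ_ ; _*_ = _*ᴱ_ ; 0# = 0ᴱ ; 1# = 1ᴱ
    ; isSemiring = record
      { isSemiringWithoutAnnihilatingZero = record
        { +-isCommutativeMonoid = record
          { isMonoid = record
            { isSemigroup = record
              { isMagma = record
                { isEquivalence = record
                  { refl  = pointwise λ _ → refl
                  ; sym   = λ p → pointwise λ x → sym (at p x)
                  ; trans = λ p q → pointwise λ x → trans (at p x) (at q x)
                  }
                ; ∙-cong = λ p q → pointwise λ x → ∙-cong (at p x) (at q x)
                }
              ; assoc = λ f g h → pointwise λ x → assoc _ _ _
              }
            ; identity = (λ f → pointwise λ x → identityˡ _) , (λ f → pointwise λ x → identityʳ _)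
            }
          ; comm = λ f g → pointwise λ x → comm _ _
          }
        ; *-cong = λ {f} {f′} {g} {g′} p q → pointwise λ x →
            trans (End.⟦⟧-cong f (at q x)) (at p (⟦ g′ ⟧ x))
        ; *-assoc = λ f g h → pointwise λ x → refl
        ; *-identity = (λ f → pointwise λ x → refl) , (λ f → pointwise λ x → refl)
        ; distrib = (λ f g h → pointwise λ x → End.homo f _ _) , (λ f g h → pointwise λ x → refl)
        }
      ; zero = (λ f → pointwise λ x → refl) , (λ f → pointwise λ x → End.ε-homo f)
      }
    }

-- Operators on the space of differential operators

module Operators {k ℓₖ c ℓ} {K : CommutativeRing k ℓₖ} {n : ℕ} (U : DifferentialAlgebra K n c ℓ) where

  open DifferentialOperators U
  private module U = DifferentialAlgebra U
  open AbelianGroupProperties U.+-abelianGroup using (xyx⁻¹≈y; ⁻¹-∙-comm)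
  open SemiringMult U.semiring using (×-congʳ; ×-comm-*) renaming (_×_ to _×ᵘ_)

  -- Equality of coefficients, as a record so that the two sides can be inferred.
  infix 4 _≃_
  record _≃_ (X Y : Diff) : Set ℓ where
    constructor equal
    field coeffs : X ≋ Y

  open _≃_ public

  -- Diff under addition of formal sums.
  diffMonoid : CommutativeMonoid c ℓ
  diffMonoid = record
    { Carrier = Diff ; _≈_ = _≃_ ; _∙_ = _++_ ; ε = []
    ; isCommutativeMonoid = record
      { isMonoid = record
        { isSemigroup = record
          { isMagma = record
            { isEquivalence = record
              { refl  = equal λ β → U.refl
              ; sym   = λ p → equal λ β → U.sym (coeffs p β)
              ; trans = λ p q → equal λ β → U.trans (coeffs p β) (coeffs q β)
              }
            ; ∙-cong = λ {X} {X′} {Y} {Y′} p q → equal λ β → U.trans (coeff-++ X Y β)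
                (U.trans (U.+-cong (coeffs p β) (coeffs q β)) (U.sym (coeff-++ X′ Y′ β)))
            }
          ; assoc = λ X Y Z → equal λ β → U.reflexive (≡.cong (λ W → coeff W β) (List.++-assoc X Y Z))
          }
        ; identity = (λ X → equal λ β → U.refl)
                   , (λ X → equal λ β → U.reflexive (≡.cong (λ W → coeff W β) (List.++-identityʳ X)))
        }
      ; comm = λ X Y → equal λ β → U.trans (coeff-++ X Y β)
          (U.trans (U.+-comm _ _) (U.sym (coeff-++ Y X β)))
      }
    }

  open Endomorphisms diffMonoid
  open Monomials semiring
  private
    module M = CommutativeMonoid diffMonoid
    module E = Semiring semiring
    module ≃-Reasoning = SetoidReasoning M.setoid
    module E-Reasoning = SetoidReasoning E.setoid
  open CommutativeSemigroupProperties (CommutativeMonoid.commutativeSemigroup E.+-commutativeMonoid)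
    using (interchange)
  open SemiringMult semiring using () renaming (_×_ to _×ᴱ_)
  open Exp semiring using (_^_)

  -- Additive maps on formal sums

  term-cong : ∀ {u v α β} → u U.≈ v → α ≡ β → (u , α) ∷ [] ≃ (v , β) ∷ []
  term-cong {α = α} u≈v ≡.refl = equal λ β →
    U.+-congʳ (proj₁ (additive-if (does (α ≟ᵉ β))) u≈v)

  term-0 : ∀ α → [] ≃ (U.0# , α) ∷ []
  term-0 α = equal λ β → U.sym (U.trans (U.+-identityʳ _) (additive-0# (additive-if (does (α ≟ᵉ β)))))

  term-+ : ∀ u v α → (u , α) ∷ (v , α) ∷ [] ≃ (u U.+ v , α) ∷ []
  term-+ u v α = equal λ β → U.trans (U.sym (U.+-assoc _ _ _))
    (U.+-congʳ (U.sym (proj₂ (additive-if (does (α ≟ᵉ β))) u v)))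

  coeff-map₁ : ∀ {g} → Additive g → ∀ X β → coeff (List.map (map₁ g) X) β U.≈ g (coeff X β)
  coeff-map₁     a []            β = U.sym (additive-0# a)
  coeff-map₁ {g} a ((u , α) ∷ X) β =
    U.trans (U.+-cong (if-g (does (α ≟ᵉ β))) (coeff-map₁ a X β)) (U.sym (proj₂ a _ _))
    where
    if-g : ∀ b → (if b then g u else U.0#) U.≈ g (if b then u else U.0#)
    if-g true  = U.refl
    if-g false = U.sym (additive-0# a)

  coeff-map₂ : ∀ h X β → coeff (List.map (map₂ h) X) β
    U.≈ total (λ u α → if does (h α ≟ᵉ β) then u else U.0#) X
  coeff-map₂ h []            β = U.refl
  coeff-map₂ h ((u , α) ∷ X) β = U.+-congˡ (coeff-map₂ h X β)

  mapCoefficients : ∀ {g} → Additive g → End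
  ⟦ mapCoefficients {g} a ⟧ = List.map (map₁ g)
  mapCoefficients {g} a .End.isMonoidHomomorphism = isAdditive
    (λ {X} {Y} p → equal λ β → U.trans (coeff-map₁ a X β)
      (U.trans (proj₁ a (coeffs p β)) (U.sym (coeff-map₁ a Y β))))
    (λ X Y → M.reflexive (List.map-++ (map₁ g) X Y))
    M.refl

  -- Application of the derivation ∂ i to all the coefficients.
  A : Fin n → End
  A i = mapCoefficients (∂-cong i , ∂-+ i)
    where open DifferentialAlgebra U using (∂-cong; ∂-+)

  -- Multiplication of all the coefficients by u.
  L : U.Carrier → End
  L u = mapCoefficients (additive-*ʳ u)

  additive-neg : Additive (λ u → U.- u)
  additive-neg = U.-‿cong , λ u v → U.sym (⁻¹-∙-comm u v)

  negate : End
  negate = mapCoefficients additive-neg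

  -- Multiplication of the symbols ∂^ α by ∂^ ε.
  shift : Exponent n → End
  ⟦ shift ε ⟧ = List.map (map₂ (ε +ᵉ_))
  shift ε .End.isMonoidHomomorphism = isAdditive
    (λ {X} {Y} p → equal λ β → U.trans (coeff-map₂ (ε +ᵉ_) X β)
      (U.trans (total-≋ _ (λ α → additive-if (does ((ε +ᵉ α) ≟ᵉ β))) {X} {Y} (coeffs p))
        (U.sym (coeff-map₂ (ε +ᵉ_) Y β))))
    (λ X Y → M.reflexive (List.map-++ (map₂ (ε +ᵉ_)) X Y))
    M.refl

  -- Multiplication of the symbols ∂^ α by ∂ i.
  B : Fin n → End
  B i = shift (single i)

  -- Left multiplication by ∂ i for ⋄, by the product rule ∂ i v = ∂ i (v) + v ∂ i.
  D : Fin n → End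
  D i = A i +ᴱ B i

  -- Additive maps are determined by their values on terms.
  ext : ∀ {f g} → (∀ u α → ⟦ f ⟧ ((u , α) ∷ []) ≃ ⟦ g ⟧ ((u , α) ∷ [])) → f ≈ᴱ g
  ext {f} {g} e = pointwise go
    where
    go : ∀ X → ⟦ f ⟧ X ≃ ⟦ g ⟧ X
    go []            = M.trans (End.ε-homo f) (M.sym (End.ε-homo g))
    go ((u , α) ∷ X) = M.trans (End.homo f ((u , α) ∷ []) X)
      (M.trans (M.∙-cong (e u α) (go X)) (M.sym (End.homo g ((u , α) ∷ []) X)))

  L-cong : ∀ {u v} → u U.≈ v → L u ≈ᴱ L v
  L-cong u≈v = ext λ w α → term-cong (U.*-congʳ u≈v) ≡.refl

  L-* : ∀ u v → L (u U.* v) ≈ᴱ L u *ᴱ L v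
  L-* u v = ext λ w α → term-cong (U.*-assoc u v w) ≡.refl

  L-comm : ∀ u v → Commute (L u) (L v)
  L-comm u v = E.trans (E.sym (L-* u v)) (E.trans (L-cong (U.*-comm u v)) (L-* v u))

  L-B-comm : ∀ u i → Commute (L u) (B i)
  L-B-comm u i = ext λ v α → term-cong U.refl ≡.refl

  A-comm : ∀ i j → Commute (A i) (A j)
  A-comm i j = ext λ u α → term-cong (U.∂-comm i j u) ≡.refl

  A-B-comm : ∀ i j → Commute (A i) (B j)
  A-B-comm i j = ext λ u α → term-cong U.refl ≡.refl

  shift-+ : ∀ α β → shift (α +ᵉ β) ≈ᴱ shift α *ᴱ shift β
  shift-+ α β = ext λ u γ → term-cong U.refl (+ᵉ-assoc α β γ)

  shift-0 : shift 0ᵉ ≈ᴱ 1ᴱ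
  shift-0 = ext λ u α → term-cong U.refl (+ᵉ-identityˡ α)

  B-comm : ∀ i j → Commute (B i) (B j)
  B-comm i j = E.trans (E.sym (shift-+ (single i) (single j)))
    (E.trans (E.reflexive (≡.cong shift (+ᵉ-comm (single i) (single j)))) (shift-+ (single j) (single i)))

  D-comm : ∀ i j → Commute (D i) (D j)
  D-comm i j = E.sym (commute-+
    (E.sym (commute-+ (A-comm i j) (A-B-comm i j)))
    (E.sym (commute-+ (E.sym (A-B-comm j i)) (B-comm i j))))

  A-leibniz : ∀ i u → A i *ᴱ L u ≈ᴱ L (U.∂ i u) +ᴱ L u *ᴱ A i
  A-leibniz i u = ext λ v α → M.trans (term-cong (U.∂-leibniz i u v) ≡.refl) (M.sym (term-+ _ _ α))

  D-leibniz : ∀ i u → D i *ᴱ L u ≈ᴱ L (U.∂ i u) +ᴱ L u *ᴱ D i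
  D-leibniz i u = begin
    (A i +ᴱ B i) *ᴱ L u                            ≈⟨ E.distribʳ (L u) (A i) (B i) ⟩
    A i *ᴱ L u +ᴱ B i *ᴱ L u                       ≈⟨ E.+-cong (A-leibniz i u) (E.sym (L-B-comm u i)) ⟩
    L (U.∂ i u) +ᴱ L u *ᴱ A i +ᴱ L u *ᴱ B i        ≈⟨ E.+-assoc _ _ _ ⟩
    L (U.∂ i u) +ᴱ (L u *ᴱ A i +ᴱ L u *ᴱ B i)      ≈⟨ E.+-congˡ (E.distribˡ (L u) (A i) (B i)) ⟨
    L (U.∂ i u) +ᴱ L u *ᴱ D i                      ∎
    where open E-Reasoning

  -- Substitution of operators for the symbols

  -- The sum of the terms u ∂^ α is sent to the sum of the L u F^α.  The order of the
  -- factors of F^α is fixed, as the F i need not commute.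
  eval : (Fin n → End) → Diff → End
  eval F X = ∑ X (λ (u , α) → L u *ᴱ monomial F α)

  module _ (F : Fin n → End) where

    eval-++ : ∀ X Y → eval F (X ++ Y) ≈ᴱ eval F X +ᴱ eval F Y
    eval-++ X Y = ∑-++ X Y

    eval-firstOrder : ∀ u → eval F (firstOrder u) ≈ᴱ ∑ (allFin n) (λ i → L (u i) *ᴱ F i)
    eval-firstOrder u = go (allFin n)
      where
      go : ∀ is → eval F (List.map (λ i → u i , single i) is) ≈ᴱ ∑ is (λ i → L (u i) *ᴱ F i)
      go []       = E.refl
      go (i ∷ is) = E.+-cong (E.*-congˡ {L (u i)} (monomial-single F i)) (go is)

    -- A bilinear multiplication is evaluation at F if it is so on terms.
    bilinear-eval : ∀ f → (∀ u α v β → ⟦ L u *ᴱ monomial F α ⟧ ((v , β) ∷ []) ≃ f (u , α) (v , β)) →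
      ∀ X Y → bilinear f X Y ≃ ⟦ eval F X ⟧ Y
    bilinear-eval f e []            Y = M.refl
    bilinear-eval f e ((u , α) ∷ X) Y = M.∙-cong (go Y) (bilinear-eval f e X Y)
      where
      g : End
      g = L u *ᴱ monomial F α
      go : ∀ Y → concatMap (f (u , α)) Y ≃ ⟦ g ⟧ Y
      go []            = M.sym (End.ε-homo g)
      go ((v , β) ∷ Y) = M.trans (M.∙-cong (M.sym (e u α v β)) (go Y)) (M.sym (End.homo g ((v , β) ∷ []) Y))

    -- The map eval F carries the action of g on its argument to composition with f.
    -- The lemmas below say that this is stable under the operations that build eval G.
    Intertwines : End → End → Set _
    Intertwines g f = ∀ Y → eval F (⟦ g ⟧ Y) ≈ᴱ f *ᴱ eval F Y

    intertwines-0 : Intertwines 0ᴱ 0ᴱ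
    intertwines-0 Y = E.sym (E.zeroˡ (eval F Y))

    intertwines-1 : Intertwines 1ᴱ 1ᴱ
    intertwines-1 Y = E.sym (E.*-identityˡ (eval F Y))

    intertwines-+ : ∀ {g g′ f f′} → Intertwines g f → Intertwines g′ f′ → Intertwines (g +ᴱ g′) (f +ᴱ f′)
    intertwines-+ {g} {g′} {f} {f′} i i′ Y = E.trans (eval-++ (⟦ g ⟧ Y) (⟦ g′ ⟧ Y))
      (E.trans (E.+-cong (i Y) (i′ Y)) (E.sym (E.distribʳ (eval F Y) f f′)))

    intertwines-* : ∀ {g g′ f f′} → Intertwines g f → Intertwines g′ f′ → Intertwines (g *ᴱ g′) (f *ᴱ f′)
    intertwines-* {g} {g′} {f} {f′} i i′ Y = E.trans (i (⟦ g′ ⟧ Y))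
      (E.trans (E.*-congˡ {f} (i′ Y)) (E.sym (E.*-assoc f f′ (eval F Y))))

    intertwines-L : ∀ u → Intertwines (L u) (L u)
    intertwines-L u []            = E.sym (E.zeroʳ (L u))
    intertwines-L u ((v , β) ∷ Y) = begin
      L (u U.* v) *ᴱ monomial F β +ᴱ eval F (⟦ L u ⟧ Y)
        ≈⟨ E.+-cong (E.trans (E.*-congʳ (L-* u v)) (E.*-assoc (L u) (L v) (monomial F β))) (intertwines-L u Y) ⟩
      L u *ᴱ (L v *ᴱ monomial F β) +ᴱ L u *ᴱ eval F Y
        ≈⟨ E.distribˡ (L u) _ _ ⟨
      L u *ᴱ (L v *ᴱ monomial F β +ᴱ eval F Y)
        ∎
      where open E-Reasoning

    intertwines-monomial : ∀ {m} {G H : Fin m → End} → (∀ i → Intertwines (G i) (H i)) →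
      ∀ α → Intertwines (monomial G α) (monomial H α)
    intertwines-monomial             i []      = intertwines-1
    intertwines-monomial {G = G} {H} i (a ∷ α) =
      intertwines-* {G zero ^ a} {monomial G′ α} {H zero ^ a} {monomial H′ α} (power a)
        (intertwines-monomial {G = G′} {H′} (λ j → i (suc j)) α)
      where
      G′ H′ : Fin _ → End
      G′ j = G (suc j)
      H′ j = H (suc j)
      power : ∀ a → Intertwines (G zero ^ a) (H zero ^ a)
      power zero    = intertwines-1
      power (suc a) = intertwines-* {G zero} {G zero ^ a} {H zero} {H zero ^ a} (i zero) (power a)

    intertwines-eval : ∀ {G} → (∀ i → Intertwines (G i) (F i)) → ∀ X → Intertwines (eval G X) (eval F X)
    intertwines-eval     i []            = intertwines-0
    intertwines-eval {G} i ((u , α) ∷ X) =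
      intertwines-+ {L u *ᴱ monomial G α} {eval G X} {L u *ᴱ monomial F α} {eval F X}
        (intertwines-* {L u} {monomial G α} {L u} {monomial F α} (intertwines-L u) (intertwines-monomial i α))
        (intertwines-eval i X)

    -- If the F i behave like the ∂ i with respect to the multiplications by functions and
    -- among themselves, then evaluation at F is an action of the differential operators.
    intertwines-D : (∀ i j → Commute (F i) (F j)) →
      (∀ i u → F i *ᴱ L u ≈ᴱ L (U.∂ i u) +ᴱ L u *ᴱ F i) →
      ∀ i → Intertwines (D i) (F i)
    intertwines-D comm leibniz i Y = E.trans (eval-++ (⟦ A i ⟧ Y) (⟦ B i ⟧ Y)) (go Y)
      where
      open E-Reasoning
      go : ∀ Y → eval F (⟦ A i ⟧ Y) +ᴱ eval F (⟦ B i ⟧ Y) ≈ᴱ F i *ᴱ eval F Y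
      go []            = E.trans (E.+-identityʳ 0ᴱ) (E.sym (E.zeroʳ (F i)))
      go ((v , β) ∷ Y) = begin
        (L (U.∂ i v) *ᴱ monomial F β +ᴱ eval F (⟦ A i ⟧ Y))
          +ᴱ (L v *ᴱ monomial F (single i +ᵉ β) +ᴱ eval F (⟦ B i ⟧ Y))
          ≈⟨ interchange _ _ _ _ ⟩
        (L (U.∂ i v) *ᴱ monomial F β +ᴱ L v *ᴱ monomial F (single i +ᵉ β))
          +ᴱ (eval F (⟦ A i ⟧ Y) +ᴱ eval F (⟦ B i ⟧ Y))
          ≈⟨ E.+-cong (E.+-congˡ (E.*-congˡ {L v} (monomial-single-+ comm i β))) (go Y) ⟩
        (L (U.∂ i v) *ᴱ monomial F β +ᴱ L v *ᴱ (F i *ᴱ monomial F β)) +ᴱ F i *ᴱ eval F Y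
          ≈⟨ E.+-congʳ (E.+-congˡ (E.*-assoc (L v) (F i) (monomial F β))) ⟨
        (L (U.∂ i v) *ᴱ monomial F β +ᴱ L v *ᴱ F i *ᴱ monomial F β) +ᴱ F i *ᴱ eval F Y
          ≈⟨ E.+-congʳ (E.distribʳ (monomial F β) (L (U.∂ i v)) (L v *ᴱ F i)) ⟨
        (L (U.∂ i v) +ᴱ L v *ᴱ F i) *ᴱ monomial F β +ᴱ F i *ᴱ eval F Y
          ≈⟨ E.+-congʳ (E.*-congʳ {monomial F β} (leibniz i v)) ⟨
        F i *ᴱ L v *ᴱ monomial F β +ᴱ F i *ᴱ eval F Y
          ≈⟨ E.+-congʳ (E.*-assoc (F i) (L v) (monomial F β)) ⟩
        F i *ᴱ (L v *ᴱ monomial F β) +ᴱ F i *ᴱ eval F Y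
          ≈⟨ E.distribˡ (F i) _ _ ⟨
        F i *ᴱ (L v *ᴱ monomial F β +ᴱ eval F Y)
          ∎

  intertwines-B : ∀ i → Intertwines B (B i) (B i)
  intertwines-B i []            = E.sym (E.zeroʳ (B i))
  intertwines-B i ((v , β) ∷ Y) = begin
    L v *ᴱ monomial B (single i +ᵉ β) +ᴱ eval B (⟦ B i ⟧ Y)
      ≈⟨ E.+-cong (E.*-congˡ {L v} (monomial-single-+ B-comm i β)) (intertwines-B i Y) ⟩
    L v *ᴱ (B i *ᴱ monomial B β) +ᴱ B i *ᴱ eval B Y
      ≈⟨ E.+-congʳ (E.*-assoc (L v) (B i) (monomial B β)) ⟨
    L v *ᴱ B i *ᴱ monomial B β +ᴱ B i *ᴱ eval B Y
      ≈⟨ E.+-congʳ (E.*-congʳ (L-B-comm v i)) ⟩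
    B i *ᴱ L v *ᴱ monomial B β +ᴱ B i *ᴱ eval B Y
      ≈⟨ E.+-congʳ (E.*-assoc (B i) (L v) (monomial B β)) ⟩
    B i *ᴱ (L v *ᴱ monomial B β) +ᴱ B i *ᴱ eval B Y
      ≈⟨ E.distribˡ (B i) _ _ ⟨
    B i *ᴱ (L v *ᴱ monomial B β +ᴱ eval B Y)
      ∎
    where open E-Reasoning

  commute-eval-B : ∀ {f} → (∀ u → Commute f (L u)) → (∀ i → Commute f (B i)) →
    ∀ X → Commute f (eval B X)
  commute-eval-B {f} fL fB []            = E.trans (E.zeroʳ f) (E.sym (E.zeroˡ f))
  commute-eval-B {f} fL fB ((u , α) ∷ X) =
    commute-+ (commute-* (fL u) (commute-monomial fB α)) (commute-eval-B fL fB X)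

  -- By applying the preceding lemma twice, once for each argument.
  eval-B-comm : ∀ X Y → Commute (eval B X) (eval B Y)
  eval-B-comm X = commute-eval-B
    (λ u → E.sym (commute-eval-B (L-comm u) (L-B-comm u) X))
    (λ i → E.sym (commute-eval-B (λ u → E.sym (L-B-comm u i)) (B-comm i) X))

  -- The three multiplications as substitutions

  monomial-A : ∀ α v β → ⟦ monomial A α ⟧ ((v , β) ∷ []) ≃ (∂^ α v , β) ∷ []
  monomial-A α v β = go Fun.id α
    where
    power : ∀ i k w → ⟦ A i ^ k ⟧ ((w , β) ∷ []) ≃ (ℕ.fold w (U.∂ i) k , β) ∷ []
    power i zero    w = M.refl
    power i (suc k) w = End.⟦⟧-cong (A i) (power i k w)

    -- Dropping the first factor of a monomial leaves a subfamily of the A i, which e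
    -- records.
    go : ∀ {m} (e : Fin m → Fin n) α → ⟦ monomial (λ i → A (e i)) α ⟧ ((v , β) ∷ [])
      ≃ (foldr (λ i w → ℕ.fold w (U.∂ (e i)) (lookup α i)) v (allFin m) , β) ∷ []
    go e []      = M.refl
    go {suc m} e (a ∷ α) = begin
      ⟦ A (e zero) ^ a ⟧ (⟦ monomial (λ i → A (e (suc i))) α ⟧ ((v , β) ∷ []))
        ≈⟨ End.⟦⟧-cong (A (e zero) ^ a) (go (λ i → e (suc i)) α) ⟩
      ⟦ A (e zero) ^ a ⟧ ((foldr (λ i → φ (suc i)) v (allFin m) , β) ∷ [])
        ≈⟨ power (e zero) a _ ⟩
      (φ zero (foldr (λ i → φ (suc i)) v (allFin m)) , β) ∷ []
        ≡⟨ ≡.cong (λ w → (φ zero w , β) ∷ []) (List.foldr-map φ suc v (allFin m)) ⟨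
      (φ zero (foldr φ v (List.map suc (allFin m))) , β) ∷ []
        ≡⟨ ≡.cong (λ is → (foldr φ v (zero ∷ is) , β) ∷ []) (List.map-tabulate Fun.id suc) ⟩
      (foldr φ v (allFin (suc m)) , β) ∷ []
        ∎
      where
      open ≃-Reasoning
      φ : Fin (suc m) → U.Carrier → U.Carrier
      φ i w = ℕ.fold w (U.∂ (e i)) (lookup (a ∷ α) i)

  monomial-B : ∀ α → monomial B α ≈ᴱ shift α
  monomial-B = monomial-hom shift shift-0 shift-+

  ×ᴱ-term : ∀ {f X v β} m → ⟦ f ⟧ X ≃ (v , β) ∷ [] → ⟦ m ×ᴱ f ⟧ X ≃ (m ×ᵘ v , β) ∷ []
  ×ᴱ-term         zero    e = term-0 _
  ×ᴱ-term {v = v} (suc m) e = M.trans (M.∙-cong e (×ᴱ-term m e)) (term-+ v (m ×ᵘ v) _)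

  -- The term u ∂^ α ⋄ v ∂^ β is the expansion of u (A + B)^α applied to v ∂^ β.
  monomial-D : ∀ u α v β → ⟦ L u *ᴱ monomial D α ⟧ ((v , β) ∷ []) ≃ diamondGen (u , α) (v , β)
  monomial-D u α v β = M.trans
    (End.⟦⟧-cong (L u) (at (monomial-+ A-B-comm α) ((v , β) ∷ [])))
    (go (below-exact α β))
    where
    open ≃-Reasoning
    t : Exponent n → End
    t γ = binom α γ ×ᴱ (monomial A γ *ᴱ monomial B (α ∸ᵉ γ))

    term : ∀ γ → (α ∸ᵉ γ) +ᵉ β ≡ (α +ᵉ β) ∸ᵉ γ → ⟦ t γ ⟧ ((v , β) ∷ [])
      ≃ (binom α γ ×ᵘ ∂^ γ v , α +ᵉ β ∸ᵉ γ) ∷ []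
    term γ exact = ×ᴱ-term {f = monomial A γ *ᴱ monomial B (α ∸ᵉ γ)} (binom α γ) (begin
      ⟦ monomial A γ ⟧ (⟦ monomial B (α ∸ᵉ γ) ⟧ ((v , β) ∷ []))
        ≈⟨ End.⟦⟧-cong (monomial A γ) (at (monomial-B (α ∸ᵉ γ)) _) ⟩
      ⟦ monomial A γ ⟧ ((v , (α ∸ᵉ γ) +ᵉ β) ∷ [])
        ≈⟨ monomial-A γ v _ ⟩
      (∂^ γ v , (α ∸ᵉ γ) +ᵉ β) ∷ []
        ≈⟨ term-cong U.refl exact ⟩
      (∂^ γ v , α +ᵉ β ∸ᵉ γ) ∷ []
        ∎)

    go : ∀ {G} → All (λ γ → (α ∸ᵉ γ) +ᵉ β ≡ (α +ᵉ β) ∸ᵉ γ) G → ⟦ L u ⟧ (⟦ ∑ G t ⟧ ((v , β) ∷ []))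
      ≃ List.map (λ γ → binom α γ ×ᵘ (u U.* ∂^ γ v) , α +ᵉ β ∸ᵉ γ) G
    go []                     = M.refl
    go (_∷_ {γ} {G} exact es) = M.trans
      (End.homo (L u) (⟦ t γ ⟧ ((v , β) ∷ [])) (⟦ ∑ G t ⟧ ((v , β) ∷ [])))
      (M.∙-cong
        (M.trans (End.⟦⟧-cong (L u) (term γ exact))
                 (term-cong (×-comm-* (binom α γ) u (∂^ γ v)) ≡.refl))
        (go es))

  ⋄-eval : ∀ X Y → X ⋄ Y ≃ ⟦ eval D X ⟧ Y
  ⋄-eval = bilinear-eval D diamondGen monomial-D

  ∘-eval : ∀ X Y → X ∘ Y ≃ ⟦ eval A X ⟧ Y
  ∘-eval = bilinear-eval A circGen λ u α v β → End.⟦⟧-cong (L u) (monomial-A α v β)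

  •-eval : ∀ X Y → X • Y ≃ ⟦ eval B X ⟧ Y
  •-eval = bilinear-eval B bulletGen λ u α v β → End.⟦⟧-cong (L u) (at (monomial-B α) ((v , β) ∷ []))

  ⋄-congʳ : ∀ Z {X Y} → X ≃ Y → X ⋄ Z ≃ Y ⋄ Z
  ⋄-congʳ Z {X} {Y} p = equal (⋄-cong {X} {Y} {Z} {Z} (coeffs p) (λ β → U.refl))

  ∘-congʳ : ∀ Z {X Y} → X ≃ Y → X ∘ Z ≃ Y ∘ Z
  ∘-congʳ Z {X} {Y} p = equal (∘-cong {X} {Y} {Z} {Z} (coeffs p) (λ β → U.refl))

  •-congʳ : ∀ Z {X Y} → X ≃ Y → X • Z ≃ Y • Z
  •-congʳ Z {X} {Y} p = equal (•-cong {X} {Y} {Z} {Z} (coeffs p) (λ β → U.refl))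

  •-congˡ : ∀ X {Y Z} → Y ≃ Z → X • Y ≃ X • Z
  •-congˡ X {Y} {Z} p = equal (•-cong {X} {X} {Y} {Z} (λ β → U.refl) (coeffs p))

  ∘-distribʳ : ∀ X Y Z → (X ⊕ Y) ∘ Z ≃ X ∘ Z ⊕ Y ∘ Z
  ∘-distribʳ X Y Z = begin
    (X ⊕ Y) ∘ Z                        ≈⟨ ∘-eval (X ⊕ Y) Z ⟩
    ⟦ eval A (X ⊕ Y) ⟧ Z               ≈⟨ at (eval-++ A X Y) Z ⟩
    ⟦ eval A X ⟧ Z ⊕ ⟦ eval A Y ⟧ Z    ≈⟨ M.∙-cong (∘-eval X Z) (∘-eval Y Z) ⟨
    X ∘ Z ⊕ Y ∘ Z                      ∎
    where open ≃-Reasoning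

  -- Associativity

  module _ (X Y Z : Diff) where

    open ≃-Reasoning

    ⋄-assoc : X ⋄ (Y ⋄ Z) ≃ (X ⋄ Y) ⋄ Z
    ⋄-assoc = begin
      X ⋄ (Y ⋄ Z)                      ≈⟨ ⋄-eval X (Y ⋄ Z) ⟩
      ⟦ eval D X ⟧ (Y ⋄ Z)             ≈⟨ End.⟦⟧-cong (eval D X) (⋄-eval Y Z) ⟩
      ⟦ eval D X ⟧ (⟦ eval D Y ⟧ Z)    ≈⟨ at (intertwines-eval D (intertwines-D D D-comm D-leibniz) X Y) Z ⟨
      ⟦ eval D (⟦ eval D X ⟧ Y) ⟧ Z    ≈⟨ ⋄-eval (⟦ eval D X ⟧ Y) Z ⟨
      ⟦ eval D X ⟧ Y ⋄ Z               ≈⟨ ⋄-congʳ Z (⋄-eval X Y) ⟨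
      (X ⋄ Y) ⋄ Z                      ∎

    -- Left multiplication for ∘ is an action of the associative algebra of ⋄.
    ∘-⋄-assoc : X ∘ (Y ∘ Z) ≃ (X ⋄ Y) ∘ Z
    ∘-⋄-assoc = begin
      X ∘ (Y ∘ Z)                      ≈⟨ ∘-eval X (Y ∘ Z) ⟩
      ⟦ eval A X ⟧ (Y ∘ Z)             ≈⟨ End.⟦⟧-cong (eval A X) (∘-eval Y Z) ⟩
      ⟦ eval A X ⟧ (⟦ eval A Y ⟧ Z)    ≈⟨ at (intertwines-eval A (intertwines-D A A-comm A-leibniz) X Y) Z ⟨
      ⟦ eval A (⟦ eval D X ⟧ Y) ⟧ Z    ≈⟨ ∘-eval (⟦ eval D X ⟧ Y) Z ⟨
      ⟦ eval D X ⟧ Y ∘ Z               ≈⟨ ∘-congʳ Z (⋄-eval X Y) ⟨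
      (X ⋄ Y) ∘ Z                      ∎

    •-assoc : X • (Y • Z) ≃ (X • Y) • Z
    •-assoc = begin
      X • (Y • Z)                      ≈⟨ •-eval X (Y • Z) ⟩
      ⟦ eval B X ⟧ (Y • Z)             ≈⟨ End.⟦⟧-cong (eval B X) (•-eval Y Z) ⟩
      ⟦ eval B X ⟧ (⟦ eval B Y ⟧ Z)    ≈⟨ at (intertwines-eval B intertwines-B X Y) Z ⟨
      ⟦ eval B (⟦ eval B X ⟧ Y) ⟧ Z    ≈⟨ •-eval (⟦ eval B X ⟧ Y) Z ⟨
      ⟦ eval B X ⟧ Y • Z               ≈⟨ •-congʳ Z (•-eval X Y) ⟨
      (X • Y) • Z                      ∎

  -- Commutativity of •

  -- The unit 1 ∂^ 0 of •.
  one : Diff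
  one = (U.1# , 0ᵉ) ∷ []

  •-identityʳ : ∀ X → X • one ≃ X
  •-identityʳ []            = M.refl
  •-identityʳ ((u , α) ∷ X) = M.∙-cong (term-cong (U.*-identityʳ u) (+ᵉ-identityʳ α)) (•-identityʳ X)

  -- Both sides are the images of the unit under commuting maps.
  •-comm : ∀ X Y → X • Y ≃ Y • X
  •-comm X Y = begin
    X • Y                              ≈⟨ •-congˡ X (•-identityʳ Y) ⟨
    X • (Y • one)                      ≈⟨ to X Y ⟩
    ⟦ eval B X ⟧ (⟦ eval B Y ⟧ one)    ≈⟨ at (eval-B-comm X Y) one ⟩
    ⟦ eval B Y ⟧ (⟦ eval B X ⟧ one)    ≈⟨ to Y X ⟨
    Y • (X • one)                      ≈⟨ •-congˡ Y (•-identityʳ X) ⟩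
    Y • X                              ∎
    where
    open ≃-Reasoning
    to : ∀ X Y → X • (Y • one) ≃ ⟦ eval B X ⟧ (⟦ eval B Y ⟧ one)
    to X Y = M.trans (•-eval X (Y • one)) (End.⟦⟧-cong (eval B X) (•-eval Y one))

  -- The associator of first-order operators

  ⊖-intro : ∀ {P Q S} → P ≃ Q ⊕ S → P ⊖ Q ≃ S
  ⊖-intro {P} {Q} {S} p = M.trans (M.∙-congʳ p) (equal λ β → begin
    coeff ((Q ⊕ S) ⊖ Q) β                       ≈⟨ coeff-++ (Q ⊕ S) (⟦ negate ⟧ Q) β ⟩
    coeff (Q ⊕ S) β U.+ coeff (⟦ negate ⟧ Q) β  ≈⟨ U.+-cong (coeff-++ Q S β) (coeff-map₁ additive-neg Q β) ⟩
    coeff Q β U.+ coeff S β U.- coeff Q β       ≈⟨ xyx⁻¹≈y (coeff Q β) (coeff S β) ⟩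
    coeff S β                                   ∎)
    where open SetoidReasoning U.setoid

  ⋄-firstOrder : ∀ u Y → firstOrder u ⋄ Y ≃ firstOrder u ∘ Y ⊕ firstOrder u • Y
  ⋄-firstOrder u Y = begin
    X ⋄ Y                              ≈⟨ ⋄-eval X Y ⟩
    ⟦ eval D X ⟧ Y                     ≈⟨ at (eval-firstOrder D u) Y ⟩
    ⟦ ∑ is (λ i → L (u i) *ᴱ D i) ⟧ Y  ≈⟨ at (split is) Y ⟩
    ⟦ ∑ is (λ i → L (u i) *ᴱ A i) ⟧ Y ⊕ ⟦ ∑ is (λ i → L (u i) *ᴱ B i) ⟧ Y
      ≈⟨ M.∙-cong (at (eval-firstOrder A u) Y) (at (eval-firstOrder B u) Y) ⟨
    ⟦ eval A X ⟧ Y ⊕ ⟦ eval B X ⟧ Y    ≈⟨ M.∙-cong (∘-eval X Y) (•-eval X Y) ⟨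
    X ∘ Y ⊕ X • Y                      ∎
    where
    open ≃-Reasoning
    X : Diff
    X = firstOrder u
    is : List (Fin n)
    is = allFin n
    split : ∀ is → ∑ is (λ i → L (u i) *ᴱ D i)
      ≈ᴱ ∑ is (λ i → L (u i) *ᴱ A i) +ᴱ ∑ is (λ i → L (u i) *ᴱ B i)
    split []       = E.sym (E.+-identityʳ 0ᴱ)
    split (i ∷ is) = E.trans (E.+-cong (E.distribˡ (L (u i)) (A i) (B i)) (split is)) (interchange _ _ _ _)

  ⋄-Vect : ∀ X Y → Vect X → X ⋄ Y ≃ X ∘ Y ⊕ X • Y
  ⋄-Vect X Y (u , X≋) = begin
    X ⋄ Y                              ≈⟨ ⋄-congʳ Y X≃ ⟩
    firstOrder u ⋄ Y                   ≈⟨ ⋄-firstOrder u Y ⟩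
    firstOrder u ∘ Y ⊕ firstOrder u • Y ≈⟨ M.∙-cong (∘-congʳ Y X≃) (•-congʳ Y X≃) ⟨
    X ∘ Y ⊕ X • Y                      ∎
    where
    open ≃-Reasoning
    X≃ : X ≃ firstOrder u
    X≃ = equal X≋

  associator-Vect : ∀ X Y Z → Vect X → associator∘ X Y Z ≃ (X • Y) ∘ Z
  associator-Vect X Y Z vX = ⊖-intro (begin
    X ∘ (Y ∘ Z)                        ≈⟨ ∘-⋄-assoc X Y Z ⟩
    (X ⋄ Y) ∘ Z                        ≈⟨ ∘-congʳ Z (⋄-Vect X Y vX) ⟩
    (X ∘ Y ⊕ X • Y) ∘ Z                ≈⟨ ∘-distribʳ (X ∘ Y) (X • Y) Z ⟩
    (X ∘ Y) ∘ Z ⊕ (X • Y) ∘ Z          ∎)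
    where open ≃-Reasoning

  associator-sym : ∀ X Y Z → Vect X → Vect Y → associator∘ X Y Z ≃ associator∘ Y X Z
  associator-sym X Y Z vX vY = begin
    associator∘ X Y Z                  ≈⟨ associator-Vect X Y Z vX ⟩
    (X • Y) ∘ Z                        ≈⟨ ∘-congʳ Z (•-comm X Y) ⟩
    (Y • X) ∘ Z                        ≈⟨ associator-Vect Y X Z vY ⟨
    associator∘ Y X Z                  ∎
    where open ≃-Reasoning

  -- Derivations of •

  -- f (Y • Z) = f Y • Z + Y • f Z for all Y and Z, stated as an equality of maps in Z.
  Derivation : End → Set _
  Derivation f = ∀ Y → f *ᴱ eval B Y ≈ᴱ eval B (⟦ f ⟧ Y) +ᴱ eval B Y *ᴱ f

  derivation-0 : Derivation 0ᴱ
  derivation-0 Y = E.trans (E.zeroˡ (eval B Y))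
    (E.sym (E.trans (E.+-identityˡ (eval B Y *ᴱ 0ᴱ)) (E.zeroʳ (eval B Y))))

  derivation-+ : ∀ {f g} → Derivation f → Derivation g → Derivation (f +ᴱ g)
  derivation-+ {f} {g} df dg Y = begin
    (f +ᴱ g) *ᴱ Y′                                                ≈⟨ E.distribʳ Y′ f g ⟩
    f *ᴱ Y′ +ᴱ g *ᴱ Y′                                            ≈⟨ E.+-cong (df Y) (dg Y) ⟩
    (eval B (⟦ f ⟧ Y) +ᴱ Y′ *ᴱ f) +ᴱ (eval B (⟦ g ⟧ Y) +ᴱ Y′ *ᴱ g)  ≈⟨ interchange _ _ _ _ ⟩
    (eval B (⟦ f ⟧ Y) +ᴱ eval B (⟦ g ⟧ Y)) +ᴱ (Y′ *ᴱ f +ᴱ Y′ *ᴱ g)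
      ≈⟨ E.+-cong (eval-++ B (⟦ f ⟧ Y) (⟦ g ⟧ Y)) (E.distribˡ Y′ f g) ⟨
    eval B (⟦ f +ᴱ g ⟧ Y) +ᴱ Y′ *ᴱ (f +ᴱ g)                       ∎
    where
    open E-Reasoning
    Y′ : End
    Y′ = eval B Y

  derivation-L* : ∀ {f} u → Derivation f → Derivation (L u *ᴱ f)
  derivation-L* {f} u df Y = begin
    L u *ᴱ f *ᴱ Y′                                   ≈⟨ E.*-assoc (L u) f Y′ ⟩
    L u *ᴱ (f *ᴱ Y′)                                 ≈⟨ E.*-congˡ {L u} (df Y) ⟩
    L u *ᴱ (eval B (⟦ f ⟧ Y) +ᴱ Y′ *ᴱ f)             ≈⟨ E.distribˡ (L u) _ _ ⟩
    L u *ᴱ eval B (⟦ f ⟧ Y) +ᴱ L u *ᴱ (Y′ *ᴱ f)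
      ≈⟨ E.+-cong (E.sym (intertwines-L B u (⟦ f ⟧ Y))) (E.sym (E.*-assoc (L u) Y′ f)) ⟩
    eval B (⟦ L u *ᴱ f ⟧ Y) +ᴱ L u *ᴱ Y′ *ᴱ f
      ≈⟨ E.+-congˡ (E.*-congʳ (commute-eval-B (L-comm u) (L-B-comm u) Y)) ⟩
    eval B (⟦ L u *ᴱ f ⟧ Y) +ᴱ Y′ *ᴱ L u *ᴱ f        ≈⟨ E.+-congˡ (E.*-assoc Y′ (L u) f) ⟩
    eval B (⟦ L u *ᴱ f ⟧ Y) +ᴱ Y′ *ᴱ (L u *ᴱ f)      ∎
    where
    open E-Reasoning
    Y′ : End
    Y′ = eval B Y

  -- The Leibniz rule on coefficients, as A i commutes with the monomials in B.
  derivation-A : ∀ i → Derivation (A i)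
  derivation-A i []            = E.trans (E.zeroʳ (A i))
    (E.sym (E.trans (E.+-identityˡ (0ᴱ *ᴱ A i)) (E.zeroˡ (A i))))
  derivation-A i ((v , β) ∷ Y) = begin
    A i *ᴱ (L v *ᴱ m +ᴱ eval B Y)                         ≈⟨ E.distribˡ (A i) _ _ ⟩
    A i *ᴱ (L v *ᴱ m) +ᴱ A i *ᴱ eval B Y                  ≈⟨ E.+-cong term (derivation-A i Y) ⟩
    (L (U.∂ i v) *ᴱ m +ᴱ L v *ᴱ m *ᴱ A i) +ᴱ (eval B (⟦ A i ⟧ Y) +ᴱ eval B Y *ᴱ A i)
      ≈⟨ interchange _ _ _ _ ⟩
    (L (U.∂ i v) *ᴱ m +ᴱ eval B (⟦ A i ⟧ Y)) +ᴱ (L v *ᴱ m *ᴱ A i +ᴱ eval B Y *ᴱ A i)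
      ≈⟨ E.+-congˡ (E.distribʳ (A i) _ _) ⟨
    (L (U.∂ i v) *ᴱ m +ᴱ eval B (⟦ A i ⟧ Y)) +ᴱ (L v *ᴱ m +ᴱ eval B Y) *ᴱ A i
      ∎
    where
    open E-Reasoning
    m : End
    m = monomial B β
    term : A i *ᴱ (L v *ᴱ m) ≈ᴱ L (U.∂ i v) *ᴱ m +ᴱ L v *ᴱ m *ᴱ A i
    term = begin
      A i *ᴱ (L v *ᴱ m)                         ≈⟨ E.*-assoc (A i) (L v) m ⟨
      A i *ᴱ L v *ᴱ m                           ≈⟨ E.*-congʳ (A-leibniz i v) ⟩
      (L (U.∂ i v) +ᴱ L v *ᴱ A i) *ᴱ m          ≈⟨ E.distribʳ m _ _ ⟩
      L (U.∂ i v) *ᴱ m +ᴱ L v *ᴱ A i *ᴱ m       ≈⟨ E.+-congˡ (E.*-assoc (L v) (A i) m) ⟩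
      L (U.∂ i v) *ᴱ m +ᴱ L v *ᴱ (A i *ᴱ m)     ≈⟨ E.+-congˡ (E.*-congˡ {L v} (commute-monomial (A-B-comm i) β)) ⟩
      L (U.∂ i v) *ᴱ m +ᴱ L v *ᴱ (m *ᴱ A i)     ≈⟨ E.+-congˡ (E.*-assoc (L v) m (A i)) ⟨
      L (U.∂ i v) *ᴱ m +ᴱ L v *ᴱ m *ᴱ A i       ∎

  ∘-•-leibniz : ∀ X Y Z → Vect X → X ∘ (Y • Z) ≃ (X ∘ Y) • Z ⊕ Y • (X ∘ Z)
  ∘-•-leibniz X Y Z (u , X≋) = begin
    X ∘ (Y • Z)                                ≈⟨ X-eval (Y • Z) ⟩
    ⟦ f ⟧ (Y • Z)                              ≈⟨ End.⟦⟧-cong f (•-eval Y Z) ⟩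
    ⟦ f ⟧ (⟦ eval B Y ⟧ Z)                     ≈⟨ at (derivation (allFin n) Y) Z ⟩
    ⟦ eval B (⟦ f ⟧ Y) ⟧ Z ⊕ ⟦ eval B Y ⟧ (⟦ f ⟧ Z)  ≈⟨ M.∙-cong (•-eval (⟦ f ⟧ Y) Z) (•-eval Y (⟦ f ⟧ Z)) ⟨
    ⟦ f ⟧ Y • Z ⊕ Y • ⟦ f ⟧ Z                  ≈⟨ M.∙-cong (•-congʳ Z (X-eval Y)) (•-congˡ Y (X-eval Z)) ⟨
    (X ∘ Y) • Z ⊕ Y • (X ∘ Z)                  ∎
    where
    open ≃-Reasoning
    -- Left multiplication by X for ∘.
    f : End
    f = ∑ (allFin n) (λ i → L (u i) *ᴱ A i)
    X-eval : ∀ W → X ∘ W ≃ ⟦ f ⟧ W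
    X-eval W = M.trans (∘-congʳ W {X} {firstOrder u} (equal X≋))
      (M.trans (∘-eval (firstOrder u) W) (at (eval-firstOrder A u) W))
    derivation : ∀ is → Derivation (∑ is (λ i → L (u i) *ᴱ A i))
    derivation []       = derivation-0
    derivation (i ∷ is) = derivation-+ {L (u i) *ᴱ A i} {∑ is (λ i → L (u i) *ᴱ A i)}
      (derivation-L* {A i} (u i) (derivation-A i)) (derivation is)

proposition2 : ∀ {k ℓₖ c ℓ} (K : CommutativeRing k ℓₖ) (n : ℕ) (U : DifferentialAlgebra K n c ℓ) →
    let open DifferentialOperators U in
    (∀ X Y Z → X ⋄ (Y ⋄ Z) ≋ (X ⋄ Y) ⋄ Z)
    × ((∀ X Y Z → X • (Y • Z) ≋ (X • Y) • Z) × (∀ X Y → X • Y ≋ Y • X))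
    × (∀ X Y Z → Vect X →
        (associator∘ X Y Z ≋ (X • Y) ∘ Z)
        × (X ∘ (Y • Z) ≋ (X ∘ Y) • Z ⊕ Y • (X ∘ Z)))
    × (∀ X Y Z → Vect X → Vect Y → associator∘ X Y Z ≋ associator∘ Y X Z)
proposition2 K n U =
    (λ X Y Z → coeffs (⋄-assoc X Y Z))
  , ((λ X Y Z → coeffs (•-assoc X Y Z)) , (λ X Y → coeffs (•-comm X Y)))
  , (λ X Y Z vX → coeffs (associator-Vect X Y Z vX) , coeffs (∘-•-leibniz X Y Z vX))
  , (λ X Y Z vX vY → coeffs (associator-sym X Y Z vX vY))
  where open Operators U
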